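{- Let $n\ge 7$ and let $G$ be a bicyclic graph on $n$ vertices. (1) $\mathrm{irr}_t(G)\ge 2n-4$. Equality holds if and only if the degree sequence of $G$ is $(3,3,2,\ldots,2)$, i.e. two vertices of degree $3$ and $n-2$ of degree $2$. (2) If the degree sequence of $G$ is not $(3,3,2,\ldots,2)$, then $\mathrm{irr}_t(G)\ge 2n-2$. Equality holds if and only if the degree sequence of $G$ is $(4,2,\ldots,2)$, i.e. one vertex of degree $4$ and $n-1$ of degree $2$. (3) If the degree sequence of $G$ is neither $(3,3,2,\ldots,2)$ nor $(4,2,\ldots,2)$, then $\mathrm{irr}_t(G)\ge 4n-10$. Equality holds if and only if the degree sequence of $G$ is $(3,3,3,2,\ldots,2,1)$, i.e. three vertices of degree $3$, $n-4$ of degree $2$ and one of degree $1$.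
   Context: A bicyclic graph is a simple connected graph whose number of edges equals its number of vertices plus one. For a graph $G=(V,E)$ and $w\in V$, $d_G(w)$ is the degree of $w$. The total irregularity is $\mathrm{irr}_t(G)=\frac12\sum_{x,y\in V}|d_G(x)-d_G(y)|$, where the sum runs over all ordered pairs of vertices. Degree sequences are listed in nonincreasing order. -}

module Defs where

open import Data.Fin.Base using (Fin; _<_)
open import Data.Fin.Properties using (_<?_)
open import Data.List.Base
  using (List; []; _∷_; map; filter; length; allFin; cartesianProduct)
import Data.List.Sort as Sort
open import Data.Nat.Base using (ℕ; _+_; _*_; ∣_-_∣)
open import Data.Nat.Divisibility using (_∣_; divides-refl; ∣m∣n⇒∣m+n; m∣m*n)
open import Data.Nat.DivMod using (_/_; m*[n/m]≡n)
open import Data.Nat.ListAction using (sum)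
open import Data.Nat.Properties using (≤-decTotalOrder; ∣-∣-comm; ∣n-n∣≡0)
open import Data.Nat.Tactic.RingSolver using (solve-∀)
open import Data.Product.Base using (_×_; _,_)
open import Level using (0ℓ)
open import Relation.Binary.Core using (Rel)
open import Relation.Binary.Construct.Closure.ReflexiveTransitive using (Star)
open import Relation.Binary.Definitions using (Decidable; Symmetric)
open import Relation.Binary.Properties.DecTotalOrder ≤-decTotalOrder
  using (≥-decTotalOrder)
open import Relation.Binary.PropositionalEquality using (_≡_; refl)
open import Relation.Nullary.Decidable using (_×-dec_)
open import Relation.Nullary.Negation.Core using (¬_)

record SimpleGraph (n : ℕ) : Set₁ where
  field
    Adj    : Rel (Fin n) 0ℓ
    adj?   : Decidable Adj
    symm   : Symmetric Adj
    irrefl : ∀ v → ¬ Adj v v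

module _ {n : ℕ} (G : SimpleGraph n) where
  open SimpleGraph G

  degree : Fin n → ℕ
  degree v = length (filter (adj? v) (allFin n))

  -- Each undirected edge is listed once, as the pair (u , v) with u < v.
  edges : List (Fin n × Fin n)
  edges = filter (λ (u , v) → (u <? v) ×-dec adj? u v)
                 (cartesianProduct (allFin n) (allFin n))

  edgeCount : ℕ
  edgeCount = length edges

  Connected : Set
  Connected = ∀ u v → Star Adj u v

  Bicyclic : Set
  Bicyclic = Connected × edgeCount ≡ n + 1

  degreeSequence : List ℕ
  degreeSequence = Sort.sort ≥-decTotalOrder (map degree (allFin n))

  orderedPairSum : ℕ
  orderedPairSum =
    sum (map (λ x → sum (map (λ y → ∣ degree x - degree y ∣) (allFin n))) (allFin n))

  -- The division is exact: see 2*irrₜ≡orderedPairSum.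
  irrₜ : ℕ
  irrₜ = orderedPairSum / 2

private
  module _ {A : Set} (f : A → A → ℕ)
           (f-diag : ∀ x → f x x ≡ 0) (f-sym : ∀ x y → f x y ≡ f y x) where

    row : A → List A → ℕ
    row x ys = sum (map (f x) ys)

    total : List A → List A → ℕ
    total xs ys = sum (map (λ x → row x ys) xs)

    rearrange : ∀ a b c d → (a + b) + (c + d) ≡ (a + c) + (b + d)
    rearrange = solve-∀

    total-∷ʳ : ∀ xs y ys → total xs (y ∷ ys) ≡ row y xs + total xs ys
    total-∷ʳ []       y ys = refl
    total-∷ʳ (x ∷ xs) y ys rewrite total-∷ʳ xs y ys | f-sym x y =
      rearrange (f y x) (row x ys) (row y xs) (total xs ys)

    double : ∀ a b → a + (a + b) ≡ 2 * a + b
    double = solve-∀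

    2∣total : ∀ xs → 2 ∣ total xs xs
    2∣total [] = divides-refl 0
    2∣total (x ∷ xs) rewrite total-∷ʳ xs x xs | f-diag x
                           | double (row x xs) (total xs xs) =
      ∣m∣n⇒∣m+n (m∣m*n (row x xs)) (2∣total xs)

2*irrₜ≡orderedPairSum : ∀ {n} (G : SimpleGraph n) → 2 * irrₜ G ≡ orderedPairSum G
2*irrₜ≡orderedPairSum {n} G = m*[n/m]≡n (2∣total
  (λ x y → ∣ degree G x - degree G y ∣)
  (λ x → ∣n-n∣≡0 (degree G x))
  (λ x y → ∣-∣-comm (degree G x) (degree G y))
  (allFin n))

module Submission where

-- Only the degree sequence matters.  Let l vertices have degree ≥ 3, with excesses over 3
-- summing to s, let z vertices have degree 2 and k degree 1.  The handshake lemma gives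
-- l + s = 2 + k, and the pairs with degrees in different classes contribute
-- z (l + s) + k (2 l + s) + z k to irrₜ.  If k = 0 the excesses are 0,0 or 1; if k = 1 and
-- l = 3 they are 0,0,0; in all other cases this contribution alone exceeds 4 n − 10.

open import Defs
open import Algebra.Properties.CommutativeSemigroup using (interchange)
open import Data.Bool.Base using (if_then_else_)
open import Data.Fin.Base as Fin using (Fin; zero; suc)
import Data.Fin.Properties as Fin
open import Data.List.Base
  using (List; _∷_; []; _++_; replicate; map; filter; length; allFin; cartesianProduct)
open import Data.List.Membership.Propositional.Properties using (∈-allFin; ∈-filter⁺; ∈-length)
open import Data.List.Properties
  using (map-∘; map-cong; map-++; length-map; length-++; length-replicate;
         length-tabulate; ++-identityʳ)
open import Data.List.Relation.Binary.Permutation.Propositional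
  using (_↭_; ↭-refl; ↭-reflexive; ↭-sym; ↭-trans; ↭⇒↭ₛ; prep)
open import Data.List.Relation.Binary.Permutation.Propositional.Properties
  using (map⁺; ++⁺ˡ; shift; ↭-length)
open import Data.List.Relation.Binary.Pointwise using (Pointwise-≡⇒≡)
open import Data.List.Relation.Unary.All as All using (All; []; _∷_)
import Data.List.Relation.Unary.All.Properties as All
open import Data.List.Relation.Unary.AllPairs using (AllPairs; []; _∷_)
import Data.List.Relation.Unary.AllPairs.Properties as AllPairs
import Data.List.Sort as Sort
import Data.List.Relation.Unary.Sorted.TotalOrder.Properties as Sorted
open import Data.Nat.Base using (ℕ; zero; suc; _+_; _*_; _∸_; _≥_; _≤_; _<_; z≤n; s≤s; ∣_-_∣)
open import Data.Nat.ListAction using (sum)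
open import Data.Nat.ListAction.Properties using (sum-++; sum-↭)
open import Data.Nat.Properties
open import Data.Nat.Tactic.RingSolver using (solve-∀)
open import Data.Product.Base using (_×_; _,_; ∃-syntax)
open import Data.Sum.Base using (_⊎_; inj₁; inj₂; [_,_]′)
open import Function.Base using (_∘_; _$_; id)
open import Function.Bundles using (_⇔_; mk⇔)
open import Level using (Level)
open import Relation.Binary.Construct.Closure.ReflexiveTransitive using (ε; _◅_)
open import Relation.Binary.Properties.DecTotalOrder ≤-decTotalOrder
  using (≥-decTotalOrder; ≥-totalOrder)
open import Relation.Binary.Definitions using (tri<; tri≈; tri>)
open import Relation.Binary.PropositionalEquality
  using (_≡_; _≢_; refl; sym; trans; cong; cong₂; subst; module ≡-Reasoning)
open import Relation.Nullary.Decidable using (Dec; yes; no; does; _×-dec_)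
open import Relation.Nullary.Negation using (¬_; contradiction)
open import Relation.Unary using (Pred; Decidable)

-- Finite sums over lists.

private
  variable
    p : Level
    A B : Set

sumBy : (A → ℕ) → List A → ℕ
sumBy f xs = sum (map f xs)

sumBy-cong : {f g : A → ℕ} → (∀ x → f x ≡ g x) → ∀ xs → sumBy f xs ≡ sumBy g xs
sumBy-cong f≗g xs = cong sum (map-cong f≗g xs)

sumBy-map : (f : B → ℕ) (g : A → B) → ∀ xs → sumBy f (map g xs) ≡ sumBy (f ∘ g) xs
sumBy-map f g xs = cong sum (sym (map-∘ xs))

sumBy-++ : (f : A → ℕ) → ∀ xs ys → sumBy f (xs ++ ys) ≡ sumBy f xs + sumBy f ys
sumBy-++ f xs ys = trans (cong sum (map-++ f xs ys)) (sum-++ (map f xs) (map f ys))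

sumBy-replicate : (f : A → ℕ) → ∀ m x → sumBy f (replicate m x) ≡ m * f x
sumBy-replicate f zero    x = refl
sumBy-replicate f (suc m) x = cong (f x +_) (sumBy-replicate f m x)

sumBy-+ : (f g : A → ℕ) → ∀ xs → sumBy (λ x → f x + g x) xs ≡ sumBy f xs + sumBy g xs
sumBy-+ f g []       = refl
sumBy-+ f g (x ∷ xs) rewrite sumBy-+ f g xs = interchange +-commutativeSemigroup (f x) (g x) _ _

sumBy-zero : (xs : List A) → sumBy (λ _ → 0) xs ≡ 0
sumBy-zero []       = refl
sumBy-zero (x ∷ xs) = sumBy-zero xs

sumBy-swap : (f : A → B → ℕ) → ∀ xs ys →
             sumBy (λ x → sumBy (f x) ys) xs ≡ sumBy (λ y → sumBy (λ x → f x y) xs) ys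
sumBy-swap f []       ys = sym (sumBy-zero ys)
sumBy-swap f (x ∷ xs) ys =
  trans (cong (sumBy (f x) ys +_) (sumBy-swap f xs ys)) (sym (sumBy-+ (f x) _ ys))

sumBy-cartesianProduct : (f : A × B → ℕ) → ∀ xs ys →
  sumBy f (cartesianProduct xs ys) ≡ sumBy (λ x → sumBy (λ y → f (x , y)) ys) xs
sumBy-cartesianProduct f []       ys = refl
sumBy-cartesianProduct f (x ∷ xs) ys =
  trans (sumBy-++ f (map (x ,_) ys) _)
        (cong₂ _+_ (sumBy-map f (x ,_) ys) (sumBy-cartesianProduct f xs ys))

-- Indicators and counting by filters.

indicator : {P : Set p} → Dec P → ℕ
indicator P? = if does P? then 1 else 0

-- Meant for `P`, `Q` the two strict orders of a pair of vertices and `R`, `R′` adjacency read in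
-- the two directions. An adjacency is then counted under exactly one order, each time in the form
-- in which `edges` tests it.
indicator-split : {P Q R R′ : Set} (P? : Dec P) (Q? : Dec Q) (R? : Dec R) (R′? : Dec R′) →
  (P → ¬ Q) → (R → R′) → (R′ → R) → (R → P ⊎ Q) →
  indicator R? ≡ indicator (P? ×-dec R?) + indicator (Q? ×-dec R′?)
indicator-split _ _ (yes r) (no ¬r′) _ to _ _ = contradiction (to r) ¬r′
indicator-split _ _ (no ¬r) (yes r′) _ _ from _ = contradiction (from r′) ¬r
indicator-split (yes p) (yes q) (yes _) (yes _) disjoint _ _ _ = contradiction q (disjoint p)
indicator-split (yes _) (no _)  (yes _) (yes _) _ _ _ _ = refl
indicator-split (no _)  (yes _) (yes _) (yes _) _ _ _ _ = refl
indicator-split (no ¬p) (no ¬q) (yes r) (yes _) _ _ _ cover =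
  contradiction (cover r) [ ¬p , ¬q ]′
indicator-split (yes _) (yes _) (no _) (no _) _ _ _ _ = refl
indicator-split (yes _) (no _)  (no _) (no _) _ _ _ _ = refl
indicator-split (no _)  (yes _) (no _) (no _) _ _ _ _ = refl
indicator-split (no _)  (no _)  (no _) (no _) _ _ _ _ = refl

length-filter≡sumBy : {P : Pred A p} (P? : Decidable P) → ∀ xs →
                      length (filter P? xs) ≡ sumBy (indicator ∘ P?) xs
length-filter≡sumBy P? []       = refl
length-filter≡sumBy P? (x ∷ xs) with P? x
... | yes _ = cong suc (length-filter≡sumBy P? xs)
... | no  _ = length-filter≡sumBy P? xs

-- Sums of absolute differences between two lists.

gap : List ℕ → List ℕ → ℕ
gap xs ys = sumBy (λ x → sumBy ∣ x -_∣ ys) xs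

gap-comm : ∀ xs ys → gap xs ys ≡ gap ys xs
gap-comm xs ys = trans (sumBy-swap ∣_-_∣ xs ys)
  (sumBy-cong (λ y → sumBy-cong (λ x → ∣-∣-comm x y) xs) ys)

gap-↭ˡ : ∀ {xs xs′} ys → xs ↭ xs′ → gap xs ys ≡ gap xs′ ys
gap-↭ˡ ys xs↭xs′ = sum-↭ (map⁺ _ xs↭xs′)

-- One argument is exchanged at a time, with symmetry in between. Hence the double sum over the
-- degrees can be evaluated on any convenient rearrangement of them.
gap-↭ : ∀ {xs ys} → xs ↭ ys → gap xs xs ≡ gap ys ys
gap-↭ {xs} {ys} xs↭ys =
  trans (gap-↭ˡ xs xs↭ys) (trans (gap-comm ys xs) (gap-↭ˡ ys xs↭ys))

gap-++ˡ : ∀ xs ys zs → gap (xs ++ ys) zs ≡ gap xs zs + gap ys zs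
gap-++ˡ xs ys zs = sumBy-++ _ xs ys

gap-++ʳ : ∀ xs ys zs → gap xs (ys ++ zs) ≡ gap xs ys + gap xs zs
gap-++ʳ xs ys zs = begin
  gap xs (ys ++ zs)        ≡⟨ gap-comm xs (ys ++ zs) ⟩
  gap (ys ++ zs) xs        ≡⟨ gap-++ˡ ys zs xs ⟩
  gap ys xs + gap zs xs    ≡⟨ cong₂ _+_ (gap-comm ys xs) (gap-comm zs xs) ⟩
  gap xs ys + gap xs zs    ∎
  where open ≡-Reasoning

gap-++-square : ∀ xs ys →
  gap (xs ++ ys) (xs ++ ys) ≡ gap xs xs + 2 * gap xs ys + gap ys ys
gap-++-square xs ys
  rewrite gap-++ˡ xs ys (xs ++ ys) | gap-++ʳ xs xs ys | gap-++ʳ ys xs ys | gap-comm ys xs =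
  rearrange (gap xs xs) (gap xs ys) (gap ys ys)
  where
  rearrange : ∀ a b c → (a + b) + (b + c) ≡ a + 2 * b + c
  rearrange = solve-∀

gap-replicate : ∀ m a n b → gap (replicate m a) (replicate n b) ≡ m * (n * ∣ a - b ∣)
gap-replicate m a n b =
  trans (sumBy-replicate _ m a) (cong (m *_) (sumBy-replicate _ n b))

gap-replicate-square : ∀ m a → gap (replicate m a) (replicate m a) ≡ 0
gap-replicate-square m a rewrite gap-replicate m a m a | ∣n-n∣≡0 a | *-zeroʳ m = *-zeroʳ m

-- Every entry on the left is at least `c`, so the absolute values disappear and each pair
-- contributes `d + e`.
gap-shifted-replicate : ∀ c d es m →
  gap (map (c + d +_) es) (replicate m c) ≡ m * (d * length es + sum es)
gap-shifted-replicate c d []       m rewrite *-zeroʳ d = sym (*-zeroʳ m)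
gap-shifted-replicate c d (e ∷ es) m = begin
  sumBy ∣ c + d + e -_∣ (replicate m c) + gap (map (c + d +_) es) (replicate m c)
    ≡⟨ cong₂ _+_ (sumBy-replicate _ m c) (gap-shifted-replicate c d es m) ⟩
  m * ∣ c + d + e - c ∣ + m * (d * length es + sum es)
    ≡⟨ cong (λ h → m * h + m * (d * length es + sum es)) difference ⟩
  m * (d + e) + m * (d * length es + sum es)
    ≡⟨ rearrange m d e (length es) (sum es) ⟩
  m * (d * suc (length es) + (e + sum es)) ∎
  where
  open ≡-Reasoning
  difference : ∣ c + d + e - c ∣ ≡ d + e
  difference = begin
    ∣ c + d + e - c ∣    ≡⟨ cong ∣_- c ∣ (+-assoc c d e) ⟩
    ∣ c + (d + e) - c ∣  ≡⟨ ∣-∣-comm (c + (d + e)) c ⟩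
    ∣ c - c + (d + e) ∣  ≡⟨ ∣m-m+n∣≡n c (d + e) ⟩
    d + e                ∎
  rearrange : ∀ m d e l s → m * (d + e) + m * (d * l + s) ≡ m * (d * (1 + l) + (e + s))
  rearrange = solve-∀

-- Degree lists grouped into degrees at least 3, equal to 2, and equal to 1.

profile : List ℕ → ℕ → ℕ → List ℕ
profile es z k = map (3 +_) es ++ replicate z 2 ++ replicate k 1

↭-profile : ∀ {ds} → All (1 ≤_) ds → ∃[ es ] ∃[ z ] ∃[ k ] ds ↭ profile es z k
↭-profile [] = [] , 0 , 0 , ↭-refl
↭-profile {suc d ∷ ds} (_ ∷ ds≥1) with ↭-profile ds≥1 | d
-- The entry is `suc d`, so `d = 0` is a leaf; it has to move past both earlier blocks.
... | es , z , k , ds↭ | 0 = es , z , suc k ,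
  ↭-trans (prep 1 ds↭) (↭-sym (↭-trans
    (++⁺ˡ (map (3 +_) es) (shift 1 (replicate z 2) (replicate k 1)))
    (shift 1 (map (3 +_) es) _)))
... | es , z , k , ds↭ | 1 = es , suc z , k ,
  ↭-trans (prep 2 ds↭) (↭-sym (shift 2 (map (3 +_) es) _))
... | es , z , k , ds↭ | suc (suc e) = e ∷ es , z , k , prep (3 + e) ds↭

length-profile : ∀ es z k → length (profile es z k) ≡ length es + (z + k)
length-profile es z k
  rewrite length-++ (map (3 +_) es) {replicate z 2 ++ replicate k 1}
        | length-++ (replicate z 2) {replicate k 1}
        | length-map (3 +_) es | length-replicate z {2} | length-replicate k {1} = refl

sum-map-+ : ∀ c es → sum (map (c +_) es) ≡ c * length es + sum es
sum-map-+ c []       rewrite *-zeroʳ c = refl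
sum-map-+ c (e ∷ es) rewrite sum-map-+ c es = rearrange c e (length es) (sum es)
  where
  rearrange : ∀ c e l s → (c + e) + (c * l + s) ≡ c * (1 + l) + (e + s)
  rearrange = solve-∀

sum-replicate : ∀ m a → sum (replicate m a) ≡ m * a
sum-replicate zero    a = refl
sum-replicate (suc m) a = cong (a +_) (sum-replicate m a)

sum-profile : ∀ es z k → sum (profile es z k) ≡ 3 * length es + sum es + (z * 2 + k * 1)
sum-profile es z k
  rewrite sum-++ (map (3 +_) es) (replicate z 2 ++ replicate k 1)
        | sum-++ (replicate z 2) (replicate k 1)
        | sum-map-+ 3 es | sum-replicate z 2 | sum-replicate k 1 = refl

-- The contribution of the unordered pairs from different blocks. The factors `1` are left as the
-- block lemmas produce them, being the differences of 3 and 2 and of 2 and 1.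
mixedGap : List ℕ → ℕ → ℕ → ℕ
mixedGap es z k = z * (1 * length es + sum es) + k * (2 * length es + sum es) + z * (k * 1)

-- The two constant blocks have no internal differences, so the only term left unevaluated is the
-- nonnegative one among the degrees at least 3.
gap-profile : ∀ es z k → gap (profile es z k) (profile es z k) ≡
              gap (map (3 +_) es) (map (3 +_) es) + 2 * mixedGap es z k
gap-profile es z k
  rewrite gap-++-square (map (3 +_) es) (replicate z 2 ++ replicate k 1)
        | gap-++-square (replicate z 2) (replicate k 1)
        | gap-++ʳ (map (3 +_) es) (replicate z 2) (replicate k 1)
        | gap-shifted-replicate 2 1 es z | gap-shifted-replicate 1 2 es k
        | gap-replicate-square z 2 | gap-replicate-square k 1
        | gap-replicate z 2 k 1 =
  rearrange (gap (map (3 +_) es) (map (3 +_) es)) (z * (1 * length es + sum es))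
    (k * (2 * length es + sum es)) (z * (k * 1))
  where
  rearrange : ∀ g a b c → g + 2 * (a + b) + (0 + 2 * c + 0) ≡ g + 2 * (a + b + c)
  rearrange = solve-∀

profile-sorted : ∀ {es} → AllPairs _≥_ (map (3 +_) es) → ∀ z k → AllPairs _≥_ (profile es z k)
profile-sorted {es} es↘ z k = AllPairs.++⁺ es↘
  (AllPairs.++⁺ (constant z) (constant k) (All.replicate⁺ z (All.replicate⁺ k (s≤s z≤n))))
  (All.map⁺ (All.universal (λ e → All.++⁺ (All.replicate⁺ z (s≤s (s≤s z≤n)))
                                          (All.replicate⁺ k (s≤s z≤n))) es))
  where
  constant : ∀ {a} m → AllPairs _≥_ (replicate m a)
  constant zero    = []
  constant (suc m) = All.replicate⁺ m ≤-refl ∷ constant m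

-- Degrees and total irregularity of a graph.

module _ {n : ℕ} (G : SimpleGraph n) where
  open SimpleGraph G

  degrees : List ℕ
  degrees = map (degree G) (allFin n)

  length-degrees : length degrees ≡ n
  length-degrees = trans (length-map (degree G) (allFin n)) (length-tabulate id)

  indicator-adj : ∀ u v → indicator (adj? u v) ≡
    indicator ((u Fin.<? v) ×-dec adj? u v) + indicator ((v Fin.<? u) ×-dec adj? v u)
  indicator-adj u v = indicator-split (u Fin.<? v) (v Fin.<? u) (adj? u v) (adj? v u)
    Fin.<-asym symm symm ordered
    where
    ordered : Adj u v → u Fin.< v ⊎ v Fin.< u
    ordered uv with Fin.<-cmp u v
    ... | tri< u<v _ _  = inj₁ u<v
    ... | tri≈ _ refl _ = contradiction uv (irrefl u)
    ... | tri> _ _ v<u  = inj₂ v<u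

  -- Each degree is a row sum of adjacency indicators. Splitting them by the order of the endpoints
  -- gives two double sums, which agree after exchanging the order of summation; each counts
  -- `edges`.
  handshake : sum degrees ≡ edgeCount G + edgeCount G
  handshake = begin
    sumBy (degree G) V
      ≡⟨ sumBy-cong (λ u → length-filter≡sumBy (adj? u) V) V ⟩
    sumBy (λ u → sumBy (λ v → indicator (adj? u v)) V) V
      ≡⟨ sumBy-cong (λ u → sumBy-cong (indicator-adj u) V) V ⟩
    sumBy (λ u → sumBy (λ v → f u v + f v u) V) V
      ≡⟨ sumBy-cong (λ u → sumBy-+ (f u) (λ v → f v u) V) V ⟩
    sumBy (λ u → sumBy (f u) V + sumBy (λ v → f v u) V) V
      ≡⟨ sumBy-+ (λ u → sumBy (f u) V) _ V ⟩
    sumBy (λ u → sumBy (f u) V) V + sumBy (λ u → sumBy (λ v → f v u) V) V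
      ≡⟨ cong (sumBy (λ u → sumBy (f u) V) V +_) (sumBy-swap f V V) ⟨
    sumBy (λ u → sumBy (f u) V) V + sumBy (λ u → sumBy (f u) V) V
      ≡⟨ cong₂ _+_ count count ⟨
    edgeCount G + edgeCount G ∎
    where
    open ≡-Reasoning
    V : List (Fin n)
    V = allFin n
    f : Fin n → Fin n → ℕ
    f u v = indicator ((u Fin.<? v) ×-dec adj? u v)
    count : edgeCount G ≡ sumBy (λ u → sumBy (f u) V) V
    count = trans (length-filter≡sumBy _ (cartesianProduct V V))
                  (sumBy-cartesianProduct _ V V)

  orderedPairSum≡gap : orderedPairSum G ≡ gap degrees degrees
  orderedPairSum≡gap = sym $ trans (sumBy-map _ (degree G) (allFin n))
    (sumBy-cong (λ x → sumBy-map ∣ degree G x -_∣ (degree G) (allFin n)) (allFin n))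

  irrₜ-profile : ∀ es z k → degrees ↭ profile es z k →
    2 * irrₜ G ≡ gap (map (3 +_) es) (map (3 +_) es) + 2 * mixedGap es z k
  irrₜ-profile es z k ds↭ = begin
    2 * irrₜ G                             ≡⟨ 2*irrₜ≡orderedPairSum G ⟩
    orderedPairSum G                       ≡⟨ orderedPairSum≡gap ⟩
    gap degrees degrees                    ≡⟨ gap-↭ ds↭ ⟩
    gap (profile es z k) (profile es z k)  ≡⟨ gap-profile es z k ⟩
    gap (map (3 +_) es) (map (3 +_) es) + 2 * mixedGap es z k ∎
    where open ≡-Reasoning

  irrₜ≥mixedGap : ∀ es z k → degrees ↭ profile es z k → mixedGap es z k ≤ irrₜ G
  irrₜ≥mixedGap es z k ds↭ = *-cancelˡ-≤ 2
    (≤-trans (m≤n+m _ (gap (map (3 +_) es) (map (3 +_) es))) (≤-reflexive (sym (irrₜ-profile es z k ds↭))))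

  -- In all three extremal sequences the degrees at least 3 coincide, so the term dropped in
  -- `irrₜ≥mixedGap` is zero there.
  irrₜ≡mixedGap : ∀ es z k → gap (map (3 +_) es) (map (3 +_) es) ≡ 0 →
    degreeSequence G ≡ profile es z k → irrₜ G ≡ mixedGap es z k
  irrₜ≡mixedGap es z k flat seq = *-cancelˡ-≡ _ _ 2
    (trans (irrₜ-profile es z k ds↭) (cong (_+ 2 * mixedGap es z k) flat))
    where
    ds↭ : degrees ↭ profile es z k
    ds↭ = ↭-trans (↭-sym (Sort.sort-↭ ≥-decTotalOrder degrees)) (↭-reflexive seq)

  degreeSequence-unique : ∀ {ys} → degrees ↭ ys → AllPairs _≥_ ys → degreeSequence G ≡ ys
  degreeSequence-unique ds↭ys ys↘ = Pointwise-≡⇒≡ $ Sorted.↗↭↗⇒≋ ≥-totalOrder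
    (Sort.sort-↗ ≥-decTotalOrder degrees)
    (Sorted.AllPairs⇒Sorted ≥-totalOrder ys↘)
    (↭⇒↭ₛ (↭-trans (Sort.sort-↭ ≥-decTotalOrder degrees) ds↭ys))

-- A walk from `v` to some other vertex cannot be empty, and its first step leads to a neighbour of
-- `v`.
connected⇒degree≥1 : ∀ {n} (G : SimpleGraph n) → 2 ≤ n → Connected G → ∀ v → 1 ≤ degree G v
connected⇒degree≥1 {suc zero} _ (s≤s ())
connected⇒degree≥1 {suc (suc _)} G _ connected v with ∃-≢ v
  where
  ∃-≢ : ∀ {m} (v : Fin (2 + m)) → ∃[ u ] v ≢ u
  ∃-≢ zero    = suc zero , λ ()
  ∃-≢ (suc _) = zero , λ ()
... | u , v≢u with connected v u
... | ε = contradiction refl v≢u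
... | vw ◅ _ = ∈-length (∈-filter⁺ (SimpleGraph.adj? G v) (∈-allFin _) vw)

-- Numerical constraints on a profile and the estimates they imply.

order-profile : ∀ {n} (G : SimpleGraph n) → ∀ es z k →
                degrees G ↭ profile es z k → length es + (z + k) ≡ n
order-profile G es z k ds↭ =
  trans (sym (length-profile es z k)) (trans (sym (↭-length ds↭)) (length-degrees G))

-- The handshake lemma reads `3 l + s + 2 z + k = 2 (l + z + k) + 2`; cancelling `2 l + 2 z + k`
-- leaves the claim.
excess-profile : ∀ {n} (G : SimpleGraph n) → edgeCount G ≡ n + 1 → ∀ es z k →
                 degrees G ↭ profile es z k → length es + sum es ≡ 2 + k
excess-profile {n} G e≡n+1 es z k ds↭ = +-cancelˡ-≡ (2 * length es + 2 * z + k) _ _ $ begin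
  2 * l + 2 * z + k + (l + s)               ≡⟨ rearrangeˡ l s z k ⟩
  3 * l + s + (z * 2 + k * 1)               ≡⟨ sum-profile es z k ⟨
  sum (profile es z k)                      ≡⟨ sum-↭ ds↭ ⟨
  sum (degrees G)                           ≡⟨ handshake G ⟩
  edgeCount G + edgeCount G                 ≡⟨ cong (λ e → e + e) e≡n+1 ⟩
  (n + 1) + (n + 1)                         ≡⟨ cong (λ m → (m + 1) + (m + 1)) (order-profile G es z k ds↭) ⟨
  (l + (z + k) + 1) + (l + (z + k) + 1)     ≡⟨ rearrangeʳ l z k ⟩
  2 * l + 2 * z + k + (2 + k)               ∎
  where
  open ≡-Reasoning
  l s : ℕ
  l = length es
  s = sum es
  rearrangeˡ : ∀ l s z k → 2 * l + 2 * z + k + (l + s) ≡ 3 * l + s + (z * 2 + k * 1)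
  rearrangeˡ = solve-∀
  rearrangeʳ : ∀ l z k → (l + (z + k) + 1) + (l + (z + k) + 1) ≡ 2 * l + 2 * z + k + (2 + k)
  rearrangeʳ = solve-∀

-- With one leaf the slack beyond strictness is `8 - 3 l`, whence 8, 5 and 2. At `l = 3` it would be
-- `-1`, that is, equality: the case of three cubic vertices. The 10 stands on the right to avoid
-- truncated subtraction.
large-one-leaf : ∀ l s z → l ≤ 2 → l + s ≡ 3 →
  4 * (l + (z + 1)) < z * (1 * l + s) + 1 * (2 * l + s) + z * (1 * 1) + 10
large-one-leaf 0 .3 z _ refl = m+n≤o⇒m≤o _ (≤-reflexive (eq z))
  where
  eq : ∀ z → 1 + 4 * (0 + (z + 1)) + 8 ≡ z * (1 * 0 + 3) + 1 * (2 * 0 + 3) + z * (1 * 1) + 10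
  eq = solve-∀
large-one-leaf 1 .2 z _ refl = m+n≤o⇒m≤o _ (≤-reflexive (eq z))
  where
  eq : ∀ z → 1 + 4 * (1 + (z + 1)) + 5 ≡ z * (1 * 1 + 2) + 1 * (2 * 1 + 2) + z * (1 * 1) + 10
  eq = solve-∀
large-one-leaf 2 .1 z _ refl = m+n≤o⇒m≤o _ (≤-reflexive (eq z))
  where
  eq : ∀ z → 1 + 4 * (2 + (z + 1)) + 2 ≡ z * (1 * 2 + 1) + 1 * (2 * 2 + 1) + z * (1 * 1) + 10
  eq = solve-∀
large-one-leaf (suc (suc (suc _))) _ _ (s≤s (s≤s ())) _

-- With `k = 2 + j` leaves the difference of the two sides is a polynomial with nonnegative
-- coefficients and positive constant term.
large-many-leaves : ∀ l s z j → l + s ≡ 2 + (2 + j) →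
  4 * (l + (z + (2 + j))) < z * (1 * l + s) + (2 + j) * (2 * l + s) + z * ((2 + j) * 1) + 10
large-many-leaves l s z j l+s≡4+j = m+n≤o⇒m≤o _ $ ≤-reflexive $ begin
  1 + 4 * (l + (z + (2 + j))) + (2 * z + 2 * j * z + 2 * s + j * l + j * j + 1)
    ≡⟨ expandˡ l s z j ⟩
  f (2 + (2 + j))
    ≡⟨ cong f l+s≡4+j ⟨
  f (l + s)
    ≡⟨ expandʳ l s z j ⟩
  z * (1 * l + s) + (2 + j) * (2 * l + s) + z * ((2 + j) * 1) + 10 ∎
  where
  open ≡-Reasoning
  -- The right-hand side with `t` for selected occurrences of `l + s`, so that the hypothesis is
  -- substituted only there. The summand `2 * (2 * l + s)` keeps its `4 l`, which matches the `4 l`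
  -- on the left.
  f : ℕ → ℕ
  f t = z * t + (2 * (2 * l + s) + j * (l + t)) + z * (2 + j) + 10
  expandˡ : ∀ l s z j →
    1 + 4 * (l + (z + (2 + j))) + (2 * z + 2 * j * z + 2 * s + j * l + j * j + 1) ≡
    z * (2 + (2 + j)) + (2 * (2 * l + s) + j * (l + (2 + (2 + j)))) + z * (2 + j) + 10
  expandˡ = solve-∀
  expandʳ : ∀ l s z j →
    z * (l + s) + (2 * (2 * l + s) + j * (l + (l + s))) + z * (2 + j) + 10 ≡
    z * (1 * l + s) + (2 + j) * (2 * l + s) + z * ((2 + j) * 1) + 10
  expandʳ = solve-∀

-- Classification of the admissible profiles.

data Classified (z : ℕ) : List ℕ → ℕ → Set where
  two-cubic   : Classified z (0 ∷ 0 ∷ []) 0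
  one-quartic : Classified z (1 ∷ []) 0
  three-cubic : Classified z (0 ∷ 0 ∷ 0 ∷ []) 1
  large       : ∀ {es k} → 4 * (length es + (z + k)) < mixedGap es z k + 10 → Classified z es k

-- For at most one leaf the equation bounds both length and sum by 3, leaving few lists; unlisted
-- lengths contradict it outright. The order of `es` causes no further cases, as the exceptional
-- lists are constant.
classify : ∀ es z k → length es + sum es ≡ 2 + k → Classified z es k
classify (0 ∷ []) z 0 ()
classify (1 ∷ []) z 0 refl = one-quartic
classify (suc (suc _) ∷ []) z 0 ()
classify (0 ∷ 0 ∷ []) z 0 refl = two-cubic
classify (0 ∷ suc _ ∷ []) z 0 ()
classify (suc _ ∷ _ ∷ []) z 0 ()
classify es@[] z 1 eq = large (large-one-leaf 0 (sum es) z z≤n eq)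
classify es@(_ ∷ []) z 1 eq = large (large-one-leaf 1 (sum es) z (s≤s z≤n) eq)
classify es@(_ ∷ _ ∷ []) z 1 eq = large (large-one-leaf 2 (sum es) z ≤-refl eq)
classify (0 ∷ 0 ∷ 0 ∷ []) z 1 refl = three-cubic
classify (0 ∷ 0 ∷ suc _ ∷ []) z 1 ()
classify (0 ∷ suc _ ∷ _ ∷ []) z 1 ()
classify (suc _ ∷ _ ∷ _ ∷ []) z 1 ()
classify es z (suc (suc j)) eq = large (large-many-leaves (length es) (sum es) z j eq)

≡∸ : ∀ {m o} n → m + n ≡ o → m ≡ o ∸ n
≡∸ {m} n m+n≡o = trans (sym (m+n∸n≡m m n)) (cong (_∸ n) m+n≡o)

-- Sequences and values of the three exceptional profiles.

module _ {n z : ℕ} where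

  two-cubic-profile : 2 + (z + 0) ≡ n →
    profile (0 ∷ 0 ∷ []) z 0 ≡ 3 ∷ 3 ∷ replicate (n ∸ 2) 2
  two-cubic-profile refl rewrite ++-identityʳ (replicate z 2) | +-identityʳ z = refl

  one-quartic-profile : 1 + (z + 0) ≡ n → profile (1 ∷ []) z 0 ≡ 4 ∷ replicate (n ∸ 1) 2
  one-quartic-profile refl rewrite ++-identityʳ (replicate z 2) | +-identityʳ z = refl

  three-cubic-profile : 3 + (z + 1) ≡ n →
    profile (0 ∷ 0 ∷ 0 ∷ []) z 1 ≡ 3 ∷ 3 ∷ 3 ∷ replicate (n ∸ 4) 2 ++ 1 ∷ []
  three-cubic-profile refl rewrite m+n∸n≡m z 1 = refl

  two-cubic-gap : 2 + (z + 0) ≡ n → mixedGap (0 ∷ 0 ∷ []) z 0 ≡ 2 * n ∸ 4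
  two-cubic-gap refl = ≡∸ 4 (eq z)
    where
    eq : ∀ z → z * 2 + 0 + z * 0 + 4 ≡ 2 * (2 + (z + 0))
    eq = solve-∀

  one-quartic-gap : 1 + (z + 0) ≡ n → mixedGap (1 ∷ []) z 0 ≡ 2 * n ∸ 2
  one-quartic-gap refl = ≡∸ 2 (eq z)
    where
    eq : ∀ z → z * 2 + 0 + z * 0 + 2 ≡ 2 * (1 + (z + 0))
    eq = solve-∀

  three-cubic-gap : 3 + (z + 1) ≡ n → mixedGap (0 ∷ 0 ∷ 0 ∷ []) z 1 ≡ 4 * n ∸ 10
  three-cubic-gap refl = ≡∸ 10 (eq z)
    where
    eq : ∀ z → z * 3 + 6 + z * 1 + 10 ≡ 4 * (3 + (z + 1))
    eq = solve-∀

-- The common form of the three claims: once failure of `P` forces a strict inequality, the bound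
-- and its equality case follow together.
minimum-characterised : ∀ {P : Set} {i a} → (P → i ≡ a) → P ⊎ a < i → i ≥ a × (i ≡ a ⇔ P)
minimum-characterised value (inj₁ p)   = ≤-reflexive (sym (value p)) , mk⇔ (λ _ → p) value
minimum-characterised value (inj₂ a<i) =
  <⇒≤ a<i , mk⇔ (λ i≡a → contradiction (sym i≡a) (<⇒≢ a<i)) value

-- Conclusions for bicyclic graphs.

module _ {n : ℕ} (n≥7 : n ≥ 7) (G : SimpleGraph n) where

  two-cubic⇒irrₜ : degreeSequence G ≡ 3 ∷ 3 ∷ replicate (n ∸ 2) 2 → irrₜ G ≡ 2 * n ∸ 4
  two-cubic⇒irrₜ seq = trans
    (irrₜ≡mixedGap G (0 ∷ 0 ∷ []) (n ∸ 2) 0 refl (trans seq (sym (two-cubic-profile order))))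
    (two-cubic-gap order)
    where
    order : 2 + ((n ∸ 2) + 0) ≡ n
    order = trans (cong (2 +_) (+-identityʳ (n ∸ 2))) (m+[n∸m]≡n (m+n≤o⇒m≤o 2 n≥7))

  one-quartic⇒irrₜ : degreeSequence G ≡ 4 ∷ replicate (n ∸ 1) 2 → irrₜ G ≡ 2 * n ∸ 2
  one-quartic⇒irrₜ seq = trans
    (irrₜ≡mixedGap G (1 ∷ []) (n ∸ 1) 0 refl (trans seq (sym (one-quartic-profile order))))
    (one-quartic-gap order)
    where
    order : 1 + ((n ∸ 1) + 0) ≡ n
    order = trans (cong (1 +_) (+-identityʳ (n ∸ 1))) (m+[n∸m]≡n (m+n≤o⇒m≤o 1 n≥7))

  three-cubic⇒irrₜ : degreeSequence G ≡ 3 ∷ 3 ∷ 3 ∷ replicate (n ∸ 4) 2 ++ 1 ∷ [] →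
                     irrₜ G ≡ 4 * n ∸ 10
  three-cubic⇒irrₜ seq = trans
    (irrₜ≡mixedGap G (0 ∷ 0 ∷ 0 ∷ []) (n ∸ 4) 1 refl
      (trans seq (sym (three-cubic-profile order))))
    (three-cubic-gap order)
    where
    order : 3 + ((n ∸ 4) + 1) ≡ n
    order = trans (cong (3 +_) (+-comm (n ∸ 4) 1)) (m+[n∸m]≡n (m+n≤o⇒m≤o 4 n≥7))

  classify-bicyclic : Bicyclic G →
      degreeSequence G ≡ 3 ∷ 3 ∷ replicate (n ∸ 2) 2
    ⊎ degreeSequence G ≡ 4 ∷ replicate (n ∸ 1) 2
    ⊎ degreeSequence G ≡ 3 ∷ 3 ∷ 3 ∷ replicate (n ∸ 4) 2 ++ 1 ∷ []
    ⊎ 4 * n ∸ 10 < irrₜ G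
  classify-bicyclic (connected , e≡n+1)
    with es , z , k , ds↭ ← ↭-profile (All.map⁺ (All.universal
           (connected⇒degree≥1 G (m+n≤o⇒m≤o 2 n≥7) connected) (allFin n)))
    with order ← order-profile G es z k ds↭
    with classify es z k (excess-profile G e≡n+1 es z k ds↭)
  ... | two-cubic = inj₁ $ trans
    (degreeSequence-unique G ds↭
      (profile-sorted {0 ∷ 0 ∷ []} ((≤-refl ∷ []) ∷ [] ∷ []) z 0))
    (two-cubic-profile order)
  ... | one-quartic = inj₂ $ inj₁ $ trans
    (degreeSequence-unique G ds↭ (profile-sorted {1 ∷ []} ([] ∷ []) z 0))
    (one-quartic-profile order)
  ... | three-cubic = inj₂ $ inj₂ $ inj₁ $ trans
    (degreeSequence-unique G ds↭
      (profile-sorted {0 ∷ 0 ∷ 0 ∷ []}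
        ((≤-refl ∷ ≤-refl ∷ []) ∷ (≤-refl ∷ []) ∷ [] ∷ []) z 1))
    (three-cubic-profile order)
  ... | large bound = inj₂ $ inj₂ $ inj₂ $
    -- The estimate gives `4 * n < irrₜ G + 10`. Subtracting 10 preserves strictness because
    -- `10 ≤ 28 ≤ 4 * n`.
    subst (4 * n ∸ 10 <_) (m+n∸n≡m (irrₜ G) 10) $ ∸-monoˡ-<
      (<-≤-trans (subst (λ m → 4 * m < mixedGap es z k + 10) order bound)
                 (+-monoˡ-≤ 10 (irrₜ≥mixedGap G es z k ds↭)))
      (m+n≤o⇒m≤o 10 (*-monoʳ-≤ 4 n≥7))

theorem15 : ∀ (n : ℕ) → n ≥ 7 → (G : SimpleGraph n) → Bicyclic G →
    ( irrₜ G ≥ 2 * n ∸ 4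
    × (irrₜ G ≡ 2 * n ∸ 4 ⇔ degreeSequence G ≡ 3 ∷ 3 ∷ replicate (n ∸ 2) 2))
    × (degreeSequence G ≢ 3 ∷ 3 ∷ replicate (n ∸ 2) 2 →
    irrₜ G ≥ 2 * n ∸ 2
    × (irrₜ G ≡ 2 * n ∸ 2 ⇔ degreeSequence G ≡ 4 ∷ replicate (n ∸ 1) 2))
    × (degreeSequence G ≢ 3 ∷ 3 ∷ replicate (n ∸ 2) 2 →
    degreeSequence G ≢ 4 ∷ replicate (n ∸ 1) 2 →
    irrₜ G ≥ 4 * n ∸ 10
    × (irrₜ G ≡ 4 * n ∸ 10 ⇔
    degreeSequence G ≡ 3 ∷ 3 ∷ 3 ∷ replicate (n ∸ 4) 2 ++ 1 ∷ []))
theorem15 n n≥7 G bicyclic =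
    minimum-characterised value₁ alternative₁
  , (λ ≢₁ → minimum-characterised value₂ (alternative₂ ≢₁))
  , (λ ≢₁ ≢₂ → minimum-characterised value₃ (alternative₃ ≢₁ ≢₂))
  where
  value₁ = two-cubic⇒irrₜ n≥7 G
  value₂ = one-quartic⇒irrₜ n≥7 G
  value₃ = three-cubic⇒irrₜ n≥7 G
  14≤2n : 14 ≤ 2 * n
  14≤2n = *-monoʳ-≤ 2 n≥7
  first<second : 2 * n ∸ 4 < 2 * n ∸ 2
  first<second = ∸-monoʳ-< (s≤s (s≤s (s≤s z≤n))) (m+n≤o⇒m≤o 4 14≤2n)
  second<third : 2 * n ∸ 2 < 4 * n ∸ 10
  -- `2 * n ∸ 2` is `8 + 2 * n ∸ 10` by computation, so both sides subtract 10 and it remains that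
  -- `8 < 2 * n`.
  second<third = ∸-monoˡ-< {8 + 2 * n} {10} 8+2n<4n (+-monoʳ-≤ 8 (m+n≤o⇒m≤o 2 14≤2n))
    where
    8+2n<4n : 8 + 2 * n < 4 * n
    8+2n<4n = ≤-trans (+-monoˡ-≤ (2 * n) (m+n≤o⇒m≤o 9 14≤2n))
                      (≤-reflexive (sym (*-distribʳ-+ n 2 2)))
  alternative₃ : degreeSequence G ≢ _ → degreeSequence G ≢ _ → degreeSequence G ≡ _ ⊎ _
  alternative₃ ≢₁ ≢₂ with classify-bicyclic n≥7 G bicyclic
  ... | inj₁ ≡₁        = contradiction ≡₁ ≢₁
  ... | inj₂ (inj₁ ≡₂) = contradiction ≡₂ ≢₂
  ... | inj₂ (inj₂ alternative) = alternative
  above-second : degreeSequence G ≡ _ ⊎ 4 * n ∸ 10 < irrₜ G → 2 * n ∸ 2 < irrₜ G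
  above-second (inj₁ ≡₃)     = subst (2 * n ∸ 2 <_) (sym (value₃ ≡₃)) second<third
  above-second (inj₂ third<) = <-trans second<third third<
  alternative₂ : degreeSequence G ≢ _ → degreeSequence G ≡ _ ⊎ 2 * n ∸ 2 < irrₜ G
  alternative₂ ≢₁ with classify-bicyclic n≥7 G bicyclic
  ... | inj₁ ≡₁        = contradiction ≡₁ ≢₁
  ... | inj₂ (inj₁ ≡₂) = inj₁ ≡₂
  ... | inj₂ (inj₂ alternative) = inj₂ (above-second alternative)
  -- The other exceptional sequences land in the strict branch, since their exact values lie above
  -- this minimum.
  alternative₁ : degreeSequence G ≡ _ ⊎ 2 * n ∸ 4 < irrₜ G
  alternative₁ with classify-bicyclic n≥7 G bicyclic
  ... | inj₁ ≡₁        = inj₁ ≡₁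
  ... | inj₂ (inj₁ ≡₂) = inj₂ (subst (2 * n ∸ 4 <_) (sym (value₂ ≡₂)) first<second)
  ... | inj₂ (inj₂ alternative) = inj₂ (<-trans first<second (above-second alternative))
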